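{- Let $A=(a_{j,i})\in\mathbb{Z}^{m\times n}$ and $\vec b\in\mathbb{Z}^m$. The ILP instance $A\vec x=\vec b$ with $n$ variables is feasible (has a solution in nonnegative integers) if and only if there exists a graph $G\in\mathcal{G}[A\vec x=\vec b]$ of path-width at most $2n$.
   Context: Set $a_{j,0}:=-b_j$ for $j\in[1,m]$. The class $\mathcal{G}[A\vec x=\vec b]$ consists of finite labelled (multi)graphs $G=(V,E,\{V_i\}_{i\in[0,n]},\{E_j\}_{j\in[1,m]})$ where $\{V_i\}_{i\in[0,n]}$ partitions the vertex set $V$ (a vertex in $V_i$ is "labelled by variable $i$"), $V_0$ consists of exactly one vertex, and $\{E_j\}_{j\in[1,m]}$ partitions the edge set $E$, such that for every $j\in[1,m]$: every edge of $E_j$ joins a vertex labelled $i$ with $a_{j,i}>0$ to a vertex labelled $i'$ with $a_{j,i'}<0$, and every vertex labelled $i$ is incident to exactly $|a_{j,i}|$ edges of $E_j$. For such $G$, $sol(G)=(|V_1|,\dots,|V_n|)$, and $sol(G)$ is always a solution of $A\vec x=\vec b$. Path-width is the usual path-width of the underlying graph. -}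

module Defs where

open import Data.Nat using (ℕ; zero; suc; _+_)
open import Data.Bool using (Bool; if_then_else_)
open import Data.Fin using (Fin; zero; suc; _≟_) renaming (_≤_ to _≤ᶠ_)
open import Data.Fin.Subset using (Subset; _∈_; ∣_∣)
open import Data.Integer using (ℤ; +_; -_; _*_; _<_) renaming (_+_ to _+ℤ_)
open import Data.Product using (Σ; ∃; _×_)
open import Relation.Nullary.Decidable using (⌊_⌋)
open import Relation.Binary.PropositionalEquality using (_≡_)
import Data.Nat as ℕ

count : ∀ {K} → (Fin K → Bool) → ℕ
count {zero}  p = 0
count {suc K} p = (if p zero then 1 else 0) + count (λ k → p (suc k))

sumℤ : ∀ {K} → (Fin K → ℤ) → ℤ
sumℤ {zero}  f = + 0
sumℤ {suc K} f = f zero +ℤ sumℤ (λ k → f (suc k))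

Feasible : ∀ {m n} → (Fin m → Fin n → ℤ) → (Fin m → ℤ) → Set
Feasible {m} {n} A b =
  ∃ λ (x : Fin n → ℕ) → ∀ (j : Fin m) → sumℤ (λ i → A j i * + (x i)) ≡ b j

coef : ∀ {m n} → (Fin m → Fin n → ℤ) → (Fin m → ℤ) → Fin m → Fin (suc n) → ℤ
coef A b j zero    = - (b j)
coef A b j (suc i) = A j i

-- A finite labelled multigraph with vertices Fin N and edges Fin M.
-- label v = i means v ∈ V_i (i ∈ [0,n]); col e = j means e ∈ E_j.
-- Each edge e joins src e and tgt e (the orientation is only a presentation:
-- we put the endpoint with positive coefficient as src).
record LGraph (m n : ℕ) : Set where
  field
    N     : ℕ
    M     : ℕ
    label : Fin N → Fin (suc n)
    src   : Fin M → Fin N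
    tgt   : Fin M → Fin N
    col   : Fin M → Fin m

open LGraph public

classSize : ∀ {m n} → LGraph m n → Fin (suc n) → ℕ
classSize G i = count (λ v → ⌊ label G v ≟ i ⌋)

degree : ∀ {m n} → (G : LGraph m n) → Fin m → Fin (N G) → ℕ
degree G j v =
  count (λ e → ⌊ col G e ≟ j ⌋ Data.Bool.∧ ⌊ src G e ≟ v ⌋)
  + count (λ e → ⌊ col G e ≟ j ⌋ Data.Bool.∧ ⌊ tgt G e ≟ v ⌋)
  where import Data.Bool

InClass : ∀ {m n} → (Fin m → Fin n → ℤ) → (Fin m → ℤ) → LGraph m n → Set
InClass {m} {n} A b G =
  (classSize G zero ≡ 1)
  × (∀ (e : Fin (M G)) →
       (+ 0 < coef A b (col G e) (label G (src G e)))
       × (coef A b (col G e) (label G (tgt G e)) < + 0))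
  × (∀ (j : Fin m) (v : Fin (N G)) →
       degree G j v ≡ Data.Integer.∣ coef A b j (label G v) ∣)
  where import Data.Integer

sol : ∀ {m n} → LGraph m n → Fin n → ℕ
sol G i = classSize G (suc i)

record PathDecomposition {m n : ℕ} (G : LGraph m n) (k : ℕ) : Set where
  field
    L        : ℕ
    bag      : Fin L → Subset (N G)
    coverV   : ∀ (v : Fin (N G)) → ∃ λ p → v ∈ bag p
    coverE   : ∀ (e : Fin (M G)) → ∃ λ p → (src G e ∈ bag p) × (tgt G e ∈ bag p)
    interval : ∀ (v : Fin (N G)) (p q r : Fin L) → p ≤ᶠ q → q ≤ᶠ r →
               v ∈ bag p → v ∈ bag r → v ∈ bag q
    width    : ∀ (p : Fin L) → ∣ bag p ∣ ℕ.≤ suc k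

PathWidth≤ : ∀ {m n} → LGraph m n → ℕ → Set
PathWidth≤ G k = PathDecomposition G k

{-# OPTIONS --safe #-}

-- From a graph to a solution: for each colour the out-degrees and the in-degrees sum to
-- the number of edges of that colour, and grouping the vertices by label turns this into
-- the equation of that colour.
--
-- From a solution to a graph: variable i has x i copies (variable 0 has one). For colour j
-- with T edges in total, the positive stubs are distributed over T time slots by the
-- earliest-deadline-first rule, so that the s-th of the w = x i * a stubs of variable i
-- falls into a slot p with s / w < (p + 1) / T and p / T < (s + 1) / w; the negative stubs
-- likewise, and the p-th edge joins the two stubs in slot p. Since slots are no longer than
-- the lifetime 1 / x i of a copy, at the time t = p / T both endpoints are copies number
-- ⌊ x i * t ⌋ or ⌊ x i * t ⌋ + 1 of their variables. These copies form the bag at time t,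
-- whatever the colour: at most two for each i ≥ 1 and one for i = 0.

module Submission where

open import Defs
open import Data.Nat using (ℕ; _*_)
open import Data.Fin using (Fin)
open import Data.Integer using (ℤ)
open import Data.Product using (Σ; _×_)
open import Function.Bundles using (_⇔_)

open import Data.Bool using (Bool; true; false; _∧_; if_then_else_)
open import Data.Empty using (⊥-elim)
open import Data.Fin using (zero; suc; toℕ; fromℕ<; _≟_; _↑ˡ_; _↑ʳ_; splitAt)
open import Data.Fin.Properties
  using (any?; toℕ<n; toℕ-fromℕ<; toℕ-injective; splitAt-↑ˡ; splitAt-↑ʳ; splitAt⁻¹-↑ˡ; splitAt⁻¹-↑ʳ)
open import Data.Fin.Subset using (Subset; ∣_∣) renaming (_∈_ to _∈ₛ_)
import Data.Integer as ℤ
import Data.Integer.Properties as ℤₚ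
open import Data.Nat
  using (zero; suc; _+_; _∸_; _≤_; _<_; z≤n; s≤s; NonZero; _/_; _%_; _≤?_; _<?_; _!)
import Data.Nat as ℕ
open import Data.Nat.DivMod
  using (m*n/n≡m; m/n*n≤m; /-monoˡ-≤; m<n*o⇒m/o<n; m<n⇒m/n≡0; m/n≡1+[m∸n]/n; m≡m%n+[m/n]*n; m%n<n)
open import Data.Nat.Divisibility using (_∣_; divides; ∣-trans; m∣m*n; m≤n⇒m!∣n!)
open import Data.Nat.Properties hiding (_≟_)
open import Data.Product using (∃; _,_; proj₁; proj₂; Σ-syntax)
open import Data.Sum using (inj₁; inj₂)
open import Data.Vec using (tabulate)
open import Data.Vec.Properties using (lookup∘tabulate; lookup⇒[]=; []=⇒lookup)
open import Function using (_∘_)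
open import Function.Bundles using (mk⇔)
open import Relation.Nullary using (¬_; Dec; yes; no)
open import Relation.Nullary.Decidable using (⌊_⌋; _×-dec_)
open import Relation.Binary.PropositionalEquality

open import Algebra.Properties.AbelianGroup ℤₚ.+-0-abelianGroup using (identityˡ-unique)
open import Algebra.Properties.Semiring.Sum +-*-semiring
  using (sum; sum-cong-≗; ∑-distrib-+; ∑-comm; sum-replicate-zero; *-distribˡ-sum; *-distribʳ-sum)

-- Finite sums and counting

ind : Bool → ℕ
ind b = if b then 1 else 0

δ : ∀ {n} → Fin n → Fin n → ℕ
δ i j = ind ⌊ i ≟ j ⌋

count≡sum : ∀ {K} (p : Fin K → Bool) → count p ≡ sum (ind ∘ p)
count≡sum {zero}  p = refl
count≡sum {suc K} p = cong (ind (p zero) +_) (count≡sum (p ∘ suc))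

ind-∧ : ∀ a b → ind (a ∧ b) ≡ ind a * ind b
ind-∧ true  b = sym (+-identityʳ (ind b))
ind-∧ false b = refl

ind≤ : ∀ {a} {A : Set a} (d : Dec A) {m} → (A → 1 ≤ m) → ind ⌊ d ⌋ ≤ m
ind≤ (yes a) f = f a
ind≤ (no _)  f = z≤n

δ-refl : ∀ {n} (i : Fin n) → δ i i ≡ 1
δ-refl i with i ≟ i
... | yes _  = refl
... | no i≢i = ⊥-elim (i≢i refl)

δ-≢ : ∀ {n} {i j : Fin n} → i ≢ j → δ i j ≡ 0
δ-≢ {i = i} {j} i≢j with i ≟ j
... | yes i≡j = ⊥-elim (i≢j i≡j)
... | no _    = refl

δ-sym : ∀ {n} (i j : Fin n) → δ i j ≡ δ j i
δ-sym i j with i ≟ j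
... | yes refl = sym (δ-refl i)
... | no i≢j   = sym (δ-≢ (i≢j ∘ sym))

δ-suc : ∀ {n} (i j : Fin n) → δ (suc i) (suc j) ≡ δ i j
δ-suc i j with i ≟ j
... | yes _ = refl
... | no _  = refl

sum-mono : ∀ {n} {f g : Fin n → ℕ} → (∀ i → f i ≤ g i) → sum f ≤ sum g
sum-mono {zero}  f≤g = z≤n
sum-mono {suc n} f≤g = +-mono-≤ (f≤g zero) (sum-mono (f≤g ∘ suc))

≤sum : ∀ {n} (f : Fin n → ℕ) i → f i ≤ sum f
≤sum f zero    = m≤m+n _ _
≤sum f (suc i) = ≤-trans (≤sum (f ∘ suc) i) (m≤n+m _ _)

sum-zero : ∀ {n} {f : Fin n → ℕ} → (∀ i → f i ≡ 0) → sum f ≡ 0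
sum-zero {n} f≡0 = trans (sum-cong-≗ f≡0) (sum-replicate-zero n)

sum-squeeze : ∀ {n} {f g : Fin n → ℕ} → (∀ i → f i ≤ g i) → sum g ≤ sum f → ∀ i → f i ≡ g i
sum-squeeze {suc n} {f} {g} f≤g Σg≤Σf zero =
  ≤-antisym (f≤g zero) (+-cancelʳ-≤ (sum (f ∘ suc)) _ _
    (≤-trans (+-monoʳ-≤ (g zero) (sum-mono (f≤g ∘ suc))) Σg≤Σf))
sum-squeeze {suc n} {f} {g} f≤g Σg≤Σf (suc i) =
  sum-squeeze (f≤g ∘ suc) (+-cancelˡ-≤ (f zero) _ _
    (≤-trans (+-monoˡ-≤ _ (f≤g zero)) Σg≤Σf)) i

sum-δ : ∀ {n} (i : Fin n) (g : Fin n → ℕ) → sum (λ j → δ i j * g j) ≡ g i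
sum-δ zero    g = trans (cong (1 * g zero +_) (sum-zero {f = λ j → δ zero (suc j) * g (suc j)} λ _ → refl))
                        (trans (+-identityʳ _) (+-identityʳ _))
sum-δ (suc i) g = trans (sum-cong-≗ λ j → cong (_* g (suc j)) (δ-suc i j)) (sum-δ i (g ∘ suc))

sum-δʳ : ∀ {n} (i : Fin n) (g : Fin n → ℕ) → sum (λ j → δ j i * g j) ≡ g i
sum-δʳ i g = trans (sum-cong-≗ λ j → cong (_* g j) (δ-sym j i)) (sum-δ i g)

sum-δ1 : ∀ {n} (i : Fin n) → sum (δ i) ≡ 1
sum-δ1 i = trans (sum-cong-≗ λ j → sym (*-identityʳ (δ i j))) (sum-δ i (λ _ → 1))

-- The last term is split off because the length will count the jobs served so far, which grows by
-- one at its upper end.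
Σ< : ℕ → (ℕ → ℕ) → ℕ
Σ< zero    f = 0
Σ< (suc n) f = Σ< n f + f n

Σ<-cong : ∀ n {f g : ℕ → ℕ} → (∀ k → k < n → f k ≡ g k) → Σ< n f ≡ Σ< n g
Σ<-cong zero    f≡g = refl
Σ<-cong (suc n) f≡g = cong₂ _+_ (Σ<-cong n λ k k<n → f≡g k (m<n⇒m<1+n k<n)) (f≡g n ≤-refl)

Σ<-const : ∀ n c → Σ< n (λ _ → c) ≡ n * c
Σ<-const zero    c = refl
Σ<-const (suc n) c = trans (+-comm _ c) (cong (c +_) (Σ<-const n c))

Σ<-+ : ∀ m n (f : ℕ → ℕ) → Σ< (m + n) f ≡ Σ< m f + Σ< n (f ∘ (m +_))
Σ<-+ m zero    f rewrite +-identityʳ m = sym (+-identityʳ _)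
Σ<-+ m (suc n) f rewrite +-suc m n | Σ<-+ m n f = +-assoc (Σ< m f) _ _

-- Scheduling

leastWitness : {Q : ℕ → Set} → (∀ k → Dec (Q k)) → ∀ m → Q m →
               ∃ λ k → Q k × (∀ l → l < k → ¬ Q l)
leastWitness Q? zero    q = zero , q , λ _ ()
leastWitness Q? (suc m) q with Q? zero
... | yes q₀ = zero , q₀ , λ _ ()
... | no ¬q₀ with leastWitness (Q? ∘ suc) m q
... | k , qk , least = suc k , qk , λ { zero _ → ¬q₀ ; (suc l) (s≤s l<k) → least l l<k }

module EDF {n} (w : Fin n → ℕ) (T : ℕ) .{{_ : NonZero T}} (Σw≡T : sum w ≡ T) where

  -- Slot `p` is the time from `p / T` to `(p + 1) / T`, job `s` of index `i` the time from
  -- `s / w i` to `(s + 1) / w i`. After `c i` jobs the next one is number `c i`: it is eligible if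
  -- it begins before slot `p` ends, and due by `P` if it ends no later than `P / T`.
  Eligible : ℕ → (Fin n → ℕ) → Fin n → Set
  Eligible p c i = c i * T < w i * suc p

  Due : ℕ → (Fin n → ℕ) → Fin n → Set
  Due P c i = suc (c i) * T ≤ w i * P

  -- The number of jobs due by P and not yet served.
  demand : ℕ → (Fin n → ℕ) → Fin n → ℕ
  demand P c i = w i * P / T ∸ c i

  -- A Hall-type invariant: for every deadline `P`, the outstanding jobs due by `P` fit into the
  -- slots from `p` up to `P`.
  OnTime : ℕ → (Fin n → ℕ) → Set
  OnTime p c = ∀ P → p ≤ P → p + sum (demand P c) ≤ P

  tick : Fin n → (Fin n → ℕ) → Fin n → ℕ
  tick i₀ c i = c i + δ i₀ i

  sum-tick : ∀ i c → sum (tick i c) ≡ suc (sum c)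
  sum-tick i c = trans (∑-distrib-+ c (δ i))
                       (trans (cong (sum c +_) (sum-δ1 i)) (+-comm (sum c) 1))

  sum-w* : ∀ P → sum (λ i → w i * P) ≡ T * P
  sum-w* P = trans (sym (*-distribʳ-sum P w)) (cong (_* P) Σw≡T)

  due⇒≤ : ∀ {P c i} → Due P c i → suc (c i) ≤ w i * P / T
  due⇒≤ {P} {c} {i} due = ≤-trans (≤-reflexive (sym (m*n/n≡m (suc (c i)) T))) (/-monoˡ-≤ T due)

  -- Otherwise `c i * T ≥ w i * (p + 1)` for all `i`, and summation gives `p * T ≥ T * (p + 1)`.
  eligible : ∀ p c → sum c ≡ p → ∃ (Eligible p c)
  eligible p c Σc≡p with any? (λ i → c i * T <? w i * suc p)
  ... | yes e = e
  ... | no ¬e = ⊥-elim (<⇒≱ (*-monoʳ-< T (n<1+n p)) (begin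
    T * suc p              ≡⟨ sum-w* (suc p) ⟨
    sum (λ i → w i * suc p) ≤⟨ sum-mono (λ i → ≮⇒≥ (λ lt → ¬e (i , lt))) ⟩
    sum (λ i → c i * T)    ≡⟨ *-distribʳ-sum T c ⟨
    sum c * T              ≡⟨ cong (_* T) Σc≡p ⟩
    p * T                  ≡⟨ *-comm p T ⟩
    T * p                  ∎))
    where open ≤-Reasoning

  eligible⇒< : ∀ {p c i} → p < T → Eligible p c i → c i < w i
  eligible⇒< {p} {c} {i} p<T e =
    *-cancelʳ-< T (c i) (w i) (<-≤-trans e (*-monoʳ-≤ (w i) p<T))

  -- `P₀` is the earliest deadline among the next jobs of eligible indices. The search for it stops
  -- by `T`, since an eligible index has `c i < w i` and so its next job is due by `T`.
  earliest : ∀ p c → p < T → sum c ≡ p →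
    Σ[ i ∈ Fin n ] Eligible p c i × ∃ λ P₀ → Due P₀ c i ×
      (∀ P → P < P₀ → ∀ i′ → Eligible p c i′ → ¬ Due P c i′)
  earliest p c p<T Σc≡p with eligible p c Σc≡p
  ... | i , e with leastWitness {λ P → ∃ λ i′ → Eligible p c i′ × Due P c i′}
                     (λ P → any? λ i′ → (c i′ * T <? w i′ * suc p) ×-dec (suc (c i′) * T ≤? w i′ * P))
                     T (i , e , *-monoˡ-≤ T (eligible⇒< {c = c} p<T e))
  ... | P₀ , (i₀ , e₀ , due) , least =
    i₀ , e₀ , P₀ , due , λ P P<P₀ i′ e′ due′ → least P P<P₀ (i′ , e′ , due′)

  -- The rates `w i / T` add up to 1, so the rounded-down values of `w i * P / T` add up to at most
  -- `P`.
  onTime-start : OnTime 0 (λ _ → 0)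
  onTime-start P _ = *-cancelʳ-≤ _ P T (begin
    sum (λ i → w i * P / T) * T     ≡⟨ *-distribʳ-sum T (λ i → w i * P / T) ⟩
    sum (λ i → w i * P / T * T)     ≤⟨ sum-mono (λ i → m/n*n≤m (w i * P) T) ⟩
    sum (λ i → w i * P)             ≡⟨ sum-w* P ⟩
    T * P                           ≡⟨ *-comm T P ⟩
    P * T                           ∎)
    where open ≤-Reasoning

  -- If the job served is due by P, serving it lowers the demand; otherwise every
  -- job due by P belongs to an index already ahead of its rate up to slot p.
  onTime-step : ∀ {p c} → OnTime p c → (i₀ : Fin n) → ∀ P₀ → Due P₀ c i₀ →
    (∀ P → P < P₀ → ∀ i → Eligible p c i → ¬ Due P c i) → OnTime (suc p) (tick i₀ c)
  onTime-step {p} {c} onTime i₀ P₀ due least P p<P with P₀ ≤? P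
  ... | yes P₀≤P = begin
    suc p + sum (demand P (tick i₀ c))               ≡⟨ +-suc p _ ⟨
    p + suc (sum (demand P (tick i₀ c)))             ≡⟨ cong (p +_) (+-comm 1 _) ⟩
    p + (sum (demand P (tick i₀ c)) + 1)             ≡⟨ cong (λ z → p + (sum (demand P (tick i₀ c)) + z)) (sum-δ1 i₀) ⟨
    p + (sum (demand P (tick i₀ c)) + sum (δ i₀))    ≡⟨ cong (p +_) (∑-distrib-+ (demand P (tick i₀ c)) (δ i₀)) ⟨
    p + sum (λ i → demand P (tick i₀ c) i + δ i₀ i)  ≤⟨ +-monoʳ-≤ p (sum-mono pointwise) ⟩
    p + sum (demand P c)                             ≤⟨ onTime P (<⇒≤ p<P) ⟩
    P                                                ∎
    where
    open ≤-Reasoning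
    pointwise : ∀ i → demand P (tick i₀ c) i + δ i₀ i ≤ demand P c i
    pointwise i with i₀ ≟ i
    ... | no _ rewrite +-identityʳ (c i) = ≤-reflexive (+-identityʳ _)
    ... | yes refl = begin
      (w i * P / T ∸ (c i + 1)) + 1   ≡⟨ cong (_+ 1) (∸-+-assoc (w i * P / T) (c i) 1) ⟨
      -- The truncated subtraction loses nothing: the job served is due by `P`, so the demand of `i`
      -- is positive.
      (w i * P / T ∸ c i ∸ 1) + 1     ≡⟨ m∸n+n≡m (m<n⇒0<n∸m (due⇒≤ {P} {c} {i} (≤-trans due (*-monoʳ-≤ (w i) P₀≤P)))) ⟩
      w i * P / T ∸ c i               ∎
  ... | no P₀≰P = begin
    suc p + sum (demand P (tick i₀ c))  ≤⟨ +-monoʳ-≤ (suc p) (*-cancelʳ-≤ _ (P ∸ suc p) T scaled) ⟩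
    suc p + (P ∸ suc p)                 ≡⟨ m+[n∸m]≡n p<P ⟩
    P                                   ∎
    where
    open ≤-Reasoning
    pointwise : ∀ i → demand P c i * T ≤ w i * (P ∸ suc p)
    pointwise i with c i * T <? w i * suc p
    -- By minimality of `P₀` an eligible index is not due by `P`, so its demand is zero.
    ... | yes e = ≤-trans (≤-reflexive (cong (_* T) (m≤n⇒m∸n≡0
                    (≤-pred (m<n*o⇒m/o<n {n = suc (c i)} (≰⇒> (least P (≰⇒> P₀≰P) i e))))))) z≤n
    ... | no ¬e = begin
      (w i * P / T ∸ c i) * T        ≡⟨ *-distribʳ-∸ T (w i * P / T) (c i) ⟩
      w i * P / T * T ∸ c i * T      ≤⟨ ∸-mono (m/n*n≤m (w i * P) T) (≮⇒≥ ¬e) ⟩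
      w i * P ∸ w i * suc p          ≡⟨ *-distribˡ-∸ (w i) P (suc p) ⟨
      w i * (P ∸ suc p)              ∎
    scaled : sum (demand P (tick i₀ c)) * T ≤ (P ∸ suc p) * T
    scaled = begin
      sum (demand P (tick i₀ c)) * T      ≤⟨ *-monoˡ-≤ T (sum-mono λ i → ∸-monoʳ-≤ (w i * P / T) (m≤m+n (c i) (δ i₀ i))) ⟩
      sum (demand P c) * T                ≡⟨ *-distribʳ-sum T (demand P c) ⟩
      sum (λ i → demand P c i * T)        ≤⟨ sum-mono pointwise ⟩
      sum (λ i → w i * (P ∸ suc p))       ≡⟨ sum-w* (P ∸ suc p) ⟩
      T * (P ∸ suc p)                     ≡⟨ *-comm T (P ∸ suc p) ⟩
      (P ∸ suc p) * T                     ∎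

  -- In the time picture, the interiors of the job and of the slot overlap.
  Window : Fin n × ℕ → ℕ → Set
  Window (i , s) p = s * T < w i * suc p × w i * p < suc s * T

  -- Sums of an arbitrary weight `h` over jobs replace an explicit bijection between slots and jobs.
  Served : (Fin n → ℕ) → (Fin n → ℕ → ℕ) → ℕ
  Served c h = sum (λ i → Σ< (c i) (h i))

  served-tick : ∀ i₀ c h → Served (tick i₀ c) h ≡ h i₀ (c i₀) + Served c h
  served-tick i₀ c h = begin
    sum (λ i → Σ< (c i + δ i₀ i) (h i))                        ≡⟨ sum-cong-≗ pointwise ⟩
    sum (λ i → δ i₀ i * h i (c i) + Σ< (c i) (h i))            ≡⟨ ∑-distrib-+ (λ i → δ i₀ i * h i (c i)) (λ i → Σ< (c i) (h i)) ⟩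
    sum (λ i → δ i₀ i * h i (c i)) + Served c h                ≡⟨ cong (_+ Served c h) (sum-δ i₀ (λ i → h i (c i))) ⟩
    h i₀ (c i₀) + Served c h                                   ∎
    where
    open ≡-Reasoning
    pointwise : ∀ i → Σ< (c i + δ i₀ i) (h i) ≡ δ i₀ i * h i (c i) + Σ< (c i) (h i)
    pointwise i with i₀ ≟ i
    ... | yes refl rewrite +-comm (c i) 1 | +-identityʳ (h i (c i)) = +-comm _ (h i (c i))
    ... | no _     rewrite +-identityʳ (c i) = refl

  slot< : ∀ {p r} → p + suc r ≡ T → p < T
  slot< {p} {r} eq = m+n≤o⇒m≤o (suc p) (≤-reflexive (trans (sym (+-suc p r)) eq))

  -- Induction on the number `r` of free slots. As `h` is arbitrary, the last component says that
  -- `σ` runs exactly once through the jobs not yet served.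
  scheduleFrom : ∀ r p → p + r ≡ T → ∀ c → sum c ≡ p → (∀ i → c i ≤ w i) → OnTime p c →
    Σ[ σ ∈ (Fin r → Fin n × ℕ) ] (∀ q → Window (σ q) (p + toℕ q)) ×
      (∀ h → sum (λ q → h (proj₁ (σ q)) (proj₂ (σ q))) + Served c h ≡ Served w h)
  -- Now `p = T`, so `c` and `w` have the same sum, and `c i ≤ w i` forces them to agree.
  scheduleFrom zero p p+0≡T c Σc≡p c≤w onTime = (λ ()) , (λ ()) , λ h →
    sum-cong-≗ λ i → cong (λ z → Σ< z (h i))
      (sum-squeeze c≤w (≤-reflexive (trans Σw≡T (trans (sym p+0≡T) (trans (+-identityʳ p) (sym Σc≡p))))) i)
  scheduleFrom (suc r) p p+1+r≡T c Σc≡p c≤w onTime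
    with earliest p c (slot< p+1+r≡T) Σc≡p
  ... | i₀ , e , P₀ , due , least
    with scheduleFrom r (suc p) (trans (sym (+-suc p r)) p+1+r≡T) (tick i₀ c)
           (trans (sum-tick i₀ c) (cong suc Σc≡p)) tick≤w (onTime-step {c = c} onTime i₀ P₀ due least)
    where
    tick≤w : ∀ i → tick i₀ c i ≤ w i
    tick≤w i with i₀ ≟ i
    ... | yes refl = ≤-trans (≤-reflexive (+-comm (c i) 1)) (eligible⇒< {c = c} (slot< p+1+r≡T) e)
    ... | no _     = ≤-trans (≤-reflexive (+-identityʳ (c i))) (c≤w i)
  ... | σ , window , served = σ′ , window′ , served′
    where
    σ′ : Fin (suc r) → Fin n × ℕ
    σ′ zero    = i₀ , c i₀
    σ′ (suc q) = σ q
    -- `OnTime` at `P = p` leaves no demand. Hence the job served now is not yet due by `p`, which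
    -- is the second half of its window.
    served₀ : w i₀ * p / T ≤ c i₀
    served₀ = m∸n≡0⇒m≤n (n≤0⇒n≡0 (≤-trans (≤sum (demand p c) i₀)
                (+-cancelˡ-≤ p _ 0 (≤-trans (onTime p ≤-refl) (≤-reflexive (sym (+-identityʳ p)))))))
    window′ : ∀ q → Window (σ′ q) (p + toℕ q)
    window′ zero rewrite +-identityʳ p = e ,
      ≰⇒> λ due′ → <⇒≱ (due⇒≤ {p} {c} {i₀} due′) served₀
    window′ (suc q) rewrite +-suc p (toℕ q) = window q
    served′ : ∀ h → sum (λ q → h (proj₁ (σ′ q)) (proj₂ (σ′ q))) + Served c h ≡ Served w h
    served′ h = begin
      h i₀ (c i₀) + R + Served c h     ≡⟨ cong (_+ Served c h) (+-comm (h i₀ (c i₀)) R) ⟩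
      R + h i₀ (c i₀) + Served c h     ≡⟨ +-assoc R _ _ ⟩
      R + (h i₀ (c i₀) + Served c h)   ≡⟨ cong (R +_) (served-tick i₀ c h) ⟨
      R + Served (tick i₀ c) h         ≡⟨ served h ⟩
      Served w h                       ∎
      where
      open ≡-Reasoning
      R = sum (λ q → h (proj₁ (σ q)) (proj₂ (σ q)))

schedule : ∀ {n} (w : Fin n → ℕ) T → sum w ≡ T →
  Σ[ σ ∈ (Fin T → Fin n × ℕ) ]
    (∀ p → let (i , s) = σ p in s * T < w i * suc (toℕ p) × w i * toℕ p < suc s * T) ×
    (∀ (h : Fin n → ℕ → ℕ) → sum (λ p → h (proj₁ (σ p)) (proj₂ (σ p))) ≡ sum (λ i → Σ< (w i) (h i)))
-- `EDF` divides by `T`, so this case is separate: there are no slots and all weights vanish.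
schedule w zero Σw≡0 = (λ ()) , (λ ()) , λ h → sym (sum-zero λ i →
  cong (λ z → Σ< z (h i)) (n≤0⇒n≡0 (≤-trans (≤sum w i) (≤-reflexive Σw≡0))))
schedule {n} w T@(suc _) Σw≡T
  with EDF.scheduleFrom w T Σw≡T T 0 refl (λ _ → 0) (sum-zero {n} {f = λ _ → 0} λ _ → refl)
         (λ _ → z≤n) (EDF.onTime-start w T Σw≡T)
... | σ , window , served = σ , window , λ h →
  trans (trans (sym (+-identityʳ _)) (cong (sum (λ p → h (proj₁ (σ p)) (proj₂ (σ p))) +_)
          (sym (sum-zero {f = λ i → Σ< 0 (h i)} λ _ → refl))))
        (served h)

-- Blocks of consecutive indices

sum-split : ∀ m {n} (f : Fin (m + n) → ℕ) → sum f ≡ sum (f ∘ (_↑ˡ n)) + sum (f ∘ (m ↑ʳ_))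
sum-split zero    f = refl
sum-split (suc m) f = trans (cong (f zero +_) (sum-split m (f ∘ suc))) (sym (+-assoc (f zero) _ _))

sum-const : ∀ n c → sum {n} (λ _ → c) ≡ n * c
sum-const zero    c = refl
sum-const (suc n) c = cong (c +_) (sum-const n c)

-- With `dec` this identifies `Fin (sum x)` with the disjoint union of the `Fin (x i)`. It serves
-- twice: for vertices grouped by variable and for edges grouped by colour.
enc : ∀ {n} (x : Fin n → ℕ) i → Fin (x i) → Fin (sum x)
enc x zero    k = k ↑ˡ sum (x ∘ suc)
enc x (suc i) k = x zero ↑ʳ enc (x ∘ suc) i k

dec : ∀ {n} (x : Fin n → ℕ) → Fin (sum x) → Σ[ i ∈ Fin n ] Fin (x i)
dec {suc n} x v with splitAt (x zero) v
... | inj₁ k  = zero , k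
... | inj₂ v′ = let (i , k) = dec (x ∘ suc) v′ in suc i , k

dec-enc : ∀ {n} (x : Fin n → ℕ) i k → dec x (enc x i k) ≡ (i , k)
dec-enc x zero    k rewrite splitAt-↑ˡ (x zero) k (sum (x ∘ suc)) = refl
dec-enc x (suc i) k rewrite splitAt-↑ʳ (x zero) (sum (x ∘ suc)) (enc (x ∘ suc) i k)
                          | dec-enc (x ∘ suc) i k = refl

enc-dec : ∀ {n} (x : Fin n → ℕ) v → enc x (proj₁ (dec x v)) (proj₂ (dec x v)) ≡ v
enc-dec {suc n} x v with splitAt (x zero) v in eq
... | inj₁ k  = splitAt⁻¹-↑ˡ eq
... | inj₂ v′ = trans (cong (x zero ↑ʳ_) (enc-dec (x ∘ suc) v′)) (splitAt⁻¹-↑ʳ eq)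

sum-enc : ∀ {n} (x : Fin n → ℕ) (f : Fin (sum x) → ℕ) → sum f ≡ sum (λ i → sum (f ∘ enc x i))
sum-enc {zero}  x f = refl
sum-enc {suc n} x f = trans (sum-split (x zero) f)
  (cong (sum (f ∘ enc x zero) +_) (sum-enc (x ∘ suc) (f ∘ (x zero ↑ʳ_))))

eqℕ : ℕ → ℕ → ℕ
eqℕ m k = ind ⌊ m ℕ.≟ k ⌋

eqℕ-refl : ∀ m → eqℕ m m ≡ 1
eqℕ-refl m with m ℕ.≟ m
... | yes _  = refl
... | no m≢m = ⊥-elim (m≢m refl)

eqℕ-≢ : ∀ {m k} → m ≢ k → eqℕ m k ≡ 0
eqℕ-≢ {m} {k} m≢k with m ℕ.≟ k
... | yes m≡k = ⊥-elim (m≢k m≡k)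
... | no _    = refl

eqℕ-suc : ∀ m k → eqℕ (suc m) (suc k) ≡ eqℕ m k
eqℕ-suc m k with m ℕ.≟ k
... | yes refl = eqℕ-refl (suc m)
... | no m≢k   = eqℕ-≢ (m≢k ∘ cong ℕ.pred)

sum-eqℕ≤1 : ∀ n m → sum {n} (λ k → eqℕ m (toℕ k)) ≤ 1
sum-eqℕ≤1 zero    m    = z≤n
sum-eqℕ≤1 (suc n) zero = ≤-reflexive (cong suc (sum-zero {n} λ k → eqℕ-≢ {0} {suc (toℕ k)} λ ()))
sum-eqℕ≤1 (suc n) (suc m) = ≤-trans (≤-reflexive (cong₂ _+_ (eqℕ-≢ {suc m} {0} λ ())
  (sum-cong-≗ {n} λ k → eqℕ-suc m (toℕ k)))) (sum-eqℕ≤1 n m)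

-- Copies of variables

module Copies {n} (x : Fin n → ℕ) where

  index : Fin (sum x) → Fin n
  index v = proj₁ (dec x v)

  copy : Fin (sum x) → ℕ
  copy v = toℕ (proj₂ (dec x v))

  copy< : ∀ v → copy v < x (index v)
  copy< v = toℕ<n (proj₂ (dec x v))

  vertex : ∀ i k → k < x i → Fin (sum x)
  vertex i k k<x = enc x i (fromℕ< k<x)

  index-enc : ∀ i k → index (enc x i k) ≡ i
  index-enc i k = cong proj₁ (dec-enc x i k)

  copy-enc : ∀ i k → copy (enc x i k) ≡ toℕ k
  copy-enc i k = cong (λ z → toℕ (proj₂ z)) (dec-enc x i k)

  copy-vertex : ∀ i k (k<x : k < x i) → copy (vertex i k k<x) ≡ k
  copy-vertex i k k<x = trans (copy-enc i _) (toℕ-fromℕ< k<x)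

  vertex-ext : ∀ u v → index u ≡ index v → copy u ≡ copy v → u ≡ v
  vertex-ext u v i≡ k≡ = trans (sym (enc-dec x u))
    (trans (cong (λ z → enc x (proj₁ z) (proj₂ z)) (pair i≡ k≡)) (enc-dec x v))
    where
    pair : ∀ {a b : Σ[ i ∈ Fin n ] Fin (x i)} →
           proj₁ a ≡ proj₁ b → toℕ (proj₂ a) ≡ toℕ (proj₂ b) → a ≡ b
    pair refl q = cong (_ ,_) (toℕ-injective q)

  -- This form depends on `u` only through its variable and copy number, so it can be a weight for
  -- `schedule`.
  δ-vertex : ∀ u v → δ u v ≡ δ (index u) (index v) * eqℕ (copy u) (copy v)
  δ-vertex u v with u ≟ v
  ... | yes refl rewrite δ-refl (index u) | eqℕ-refl (copy u) = refl
  ... | no u≢v with index u ≟ index v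
  ...   | no _   = refl
  ...   | yes i≡ = sym (trans (+-identityʳ _) (eqℕ-≢ (u≢v ∘ vertex-ext u v i≡)))

  sum-vertices : ∀ (F : Fin n → ℕ → ℕ) →
    sum (λ v → F (index v) (copy v)) ≡ sum (λ i → sum {x i} (λ k → F i (toℕ k)))
  sum-vertices F = trans (sum-enc x _)
    (sum-cong-≗ λ i → sum-cong-≗ {x i} λ k → cong₂ F (index-enc i k) (copy-enc i k))

-- Total division; the junk value 0 is never used, as an index of weight 0 is never served.
_÷_ : ℕ → ℕ → ℕ
s ÷ zero    = 0
s ÷ (suc a) = s / suc a

-- Stub `s` goes to copy `s ÷ a`, so each copy receives `a` consecutive stubs. The induction on `x`
-- removes the block of copy 0.
Σ<-div : ∀ a x k → k < x → Σ< (x * a) (λ s → eqℕ (s ÷ a) k) ≡ a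
Σ<-div zero    x k k<x rewrite *-zeroʳ x = refl
Σ<-div a@(suc _) (suc x) k k<x = trans (Σ<-+ a (x * a) _) (split k k<x)
  where
  first : ∀ k c → eqℕ 0 k ≡ c → Σ< a (λ s → eqℕ (s / a) k) ≡ a * c
  first k c eq = trans (Σ<-cong a λ s s<a → trans (cong (λ z → eqℕ z k) (m<n⇒m/n≡0 s<a)) eq)
                       (Σ<-const a c)
  shift : ∀ s → (a + s) / a ≡ suc (s / a)
  shift s = trans (m/n≡1+[m∸n]/n (m≤m+n a s)) (cong (λ z → suc (z / a)) (m+n∸m≡n a s))
  split : ∀ k → k < suc x →
    Σ< a (λ s → eqℕ (s / a) k) + Σ< (x * a) (λ s → eqℕ ((a + s) / a) k) ≡ a
  split zero _ = trans
    (cong₂ _+_ (first 0 1 refl)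
      (trans (Σ<-cong (x * a) {g = λ _ → 0} λ s _ →
               eqℕ-≢ λ eq → 1+n≢0 (trans (sym (shift s)) eq))
             (trans (Σ<-const (x * a) 0) (*-zeroʳ (x * a)))))
    (trans (+-identityʳ _) (*-identityʳ a))
  split (suc k) (s≤s k<x) = cong₂ _+_
    (trans (first (suc k) 0 (eqℕ-≢ {0} {suc k} λ ())) (*-zeroʳ a))
    (trans (Σ<-cong (x * a) λ s _ → trans (cong (λ z → eqℕ z (suc k)) (shift s)) (eqℕ-suc (s / a) k))
           (Σ<-div a x k k<x))

-- Endpoints of the edges of one colour

module _ {n} (x : Fin n → ℕ) where
  open Copies x

  -- For `t = p / T`, the copy number differs from `x (index v) * t` by less than 1.
  Timely : ℕ → ℕ → Fin (sum x) → Set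
  Timely T p v = copy v * T < x (index v) * p + T × x (index v) * p < suc (copy v) * T

  -- Let `k = s / a`. From `k * a ≤ s` follows `k * T < x i * (p + 1)`, and `x i ≤ x i * a ≤ T`
  -- bounds the right side by `x i * p + T`. From `s + 1 ≤ (k + 1) * a` follows the other
  -- inequality.
  copyAt : ∀ {T p i s} a → p < T → x i * a ≤ T → s * T < x i * a * suc p → x i * a * p < suc s * T →
           0 < a × s ÷ a < x i × s ÷ a * T < x i * p + T × x i * p < suc (s ÷ a) * T
  copyAt {T} {p} {i} {s} zero _ _ lo _ rewrite *-zeroʳ (x i) = ⊥-elim (n≮0 lo)
  copyAt {T} {p} {i} {s} a@(suc _) p<T w≤T lo hi = s≤s z≤n , m<n*o⇒m/o<n s<w , early , late
    where
    open ≤-Reasoning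
    k = s / a
    s<w : s < x i * a
    s<w = *-cancelʳ-< T s (x i * a) (<-≤-trans lo (*-monoʳ-≤ (x i * a) p<T))
    early : k * T < x i * p + T
    early = <-≤-trans (*-cancelʳ-< a (k * T) (x i * suc p) (begin-strict
      k * T * a         ≡⟨ *-assoc k T a ⟩
      k * (T * a)       ≡⟨ cong (k *_) (*-comm T a) ⟩
      k * (a * T)       ≡⟨ *-assoc k a T ⟨
      k * a * T         ≤⟨ *-monoˡ-≤ T (m/n*n≤m s a) ⟩
      s * T             <⟨ lo ⟩
      x i * a * suc p   ≡⟨ *-assoc (x i) a (suc p) ⟩
      x i * (a * suc p) ≡⟨ cong (x i *_) (*-comm a (suc p)) ⟩
      x i * (suc p * a) ≡⟨ *-assoc (x i) (suc p) a ⟨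
      x i * suc p * a   ∎)) (begin
      x i * suc p       ≡⟨ *-suc (x i) p ⟩
      x i + x i * p     ≡⟨ +-comm (x i) _ ⟩
      x i * p + x i     ≤⟨ +-monoʳ-≤ (x i * p) (≤-trans (m≤m*n (x i) a) w≤T) ⟩
      x i * p + T       ∎)
    s<[1+k]a : s < suc k * a
    s<[1+k]a = begin-strict
      s              ≡⟨ m≡m%n+[m/n]*n s a ⟩
      s % a + k * a  <⟨ +-monoˡ-< (k * a) (m%n<n s a) ⟩
      a + k * a      ∎
    late : x i * p < suc k * T
    late = *-cancelʳ-< a (x i * p) (suc k * T) (begin-strict
      x i * p * a       ≡⟨ *-assoc (x i) p a ⟩
      x i * (p * a)     ≡⟨ cong (x i *_) (*-comm p a) ⟩
      x i * (a * p)     ≡⟨ *-assoc (x i) a p ⟨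
      x i * a * p       <⟨ hi ⟩
      suc s * T         ≤⟨ *-monoˡ-≤ T s<[1+k]a ⟩
      suc k * a * T     ≡⟨ *-assoc (suc k) a T ⟩
      suc k * (a * T)   ≡⟨ cong (suc k *_) (*-comm a T) ⟩
      suc k * (T * a)   ≡⟨ *-assoc (suc k) T a ⟨
      suc k * T * a     ∎)

  endpoints : (a : Fin n → ℕ) (T : ℕ) → sum (λ i → x i * a i) ≡ T →
    Σ[ end ∈ (Fin T → Fin (sum x)) ]
      (∀ v → sum (λ p → δ (end p) v) ≡ a (index v)) ×
      (∀ p → 0 < a (index (end p)) × Timely T (toℕ p) (end p))
  endpoints a T Σ≡T with schedule (λ i → x i * a i) T Σ≡T
  ... | σ , window , served = end , degrees , λ p → positive p , timely p
    where
    I : Fin T → Fin n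
    I p = proj₁ (σ p)
    S : Fin T → ℕ
    S p = proj₂ (σ p)
    at : ∀ p → _
    at p = copyAt {T} {toℕ p} {I p} {S p} (a (I p)) (toℕ<n p)
      (≤-trans (≤sum (λ i → x i * a i) (I p)) (≤-reflexive Σ≡T))
      (proj₁ (window p)) (proj₂ (window p))
    end : Fin T → Fin (sum x)
    end p = vertex (I p) (S p ÷ a (I p)) (proj₁ (proj₂ (at p)))
    index-end : ∀ p → index (end p) ≡ I p
    index-end p = index-enc (I p) _
    copy-end : ∀ p → copy (end p) ≡ S p ÷ a (I p)
    copy-end p = copy-vertex (I p) _ (proj₁ (proj₂ (at p)))
    positive : ∀ p → 0 < a (index (end p))
    positive p = subst (λ i → 0 < a i) (sym (index-end p)) (proj₁ (at p))
    timely : ∀ p → Timely T (toℕ p) (end p)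
    timely p = subst₂ (λ i k → k * T < x i * toℕ p + T × x i * toℕ p < suc k * T)
      (sym (index-end p)) (sym (copy-end p)) (proj₂ (proj₂ (at p)))
    degrees : ∀ v → sum (λ p → δ (end p) v) ≡ a (index v)
    degrees v = begin
      sum (λ p → δ (end p) v)
        ≡⟨ sum-cong-≗ (λ p → trans (δ-vertex (end p) v)
             (cong₂ (λ i k → δ i (index v) * eqℕ k (copy v)) (index-end p) (copy-end p))) ⟩
      sum (λ p → h (I p) (S p))
        ≡⟨ served h ⟩
      sum (λ i → Σ< (x i * a i) (h i))
        ≡⟨ sum-cong-≗ (λ i → Σ<-*ˡ (x i * a i) (δ i (index v)) (λ s → eqℕ (s ÷ a i) (copy v))) ⟩
      sum (λ i → δ i (index v) * Σ< (x i * a i) (λ s → eqℕ (s ÷ a i) (copy v)))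
        ≡⟨ sum-δʳ (index v) _ ⟩
      Σ< (x (index v) * a (index v)) (λ s → eqℕ (s ÷ a (index v)) (copy v))
        ≡⟨ Σ<-div (a (index v)) (x (index v)) (copy v) (copy< v) ⟩
      a (index v) ∎
      where
      open ≡-Reasoning
      -- The indicator of the stubs attached to `v`.
      h : Fin n → ℕ → ℕ
      h i s = δ i (index v) * eqℕ (s ÷ a i) (copy v)
      Σ<-*ˡ : ∀ m c f → Σ< m (λ s → c * f s) ≡ c * Σ< m f
      Σ<-*ˡ zero    c f = sym (*-zeroʳ c)
      Σ<-*ˡ (suc m) c f = trans (cong (_+ c * f m) (Σ<-*ˡ m c f)) (sym (*-distribˡ-+ c _ _))

-- Splitting the linear system by sign

-- Opened only here: the constructor +_ makes sections such as (m +_) ambiguous.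
open import Data.Integer using (+_; -[1+_]) renaming (_+_ to _+ℤ_)

pos neg : ℤ → ℕ
pos (+ n)    = n
pos -[1+ n ] = 0
neg (+ n)    = 0
neg -[1+ n ] = suc n

pos+neg : ∀ z → pos z + neg z ≡ ℤ.∣ z ∣
pos+neg (+ n)    = +-identityʳ n
pos+neg -[1+ n ] = refl

0<pos⇒0< : ∀ z → 0 < pos z → + 0 ℤ.< z
0<pos⇒0< (+ n) 0<n = ℤ.+<+ 0<n

0<neg⇒<0 : ∀ z → 0 < neg z → z ℤ.< + 0
0<neg⇒<0 -[1+ n ] _ = ℤ.-<+

-- For `s` and `t` the out- and in-degree of a vertex in one colour: the sign of its coefficient `z`
-- decides which of them carries the whole degree.
sign-split : ∀ {s t} z → s + t ≡ ℤ.∣ z ∣ → (¬ + 0 ℤ.< z → s ≡ 0) → (¬ z ℤ.< + 0 → t ≡ 0) →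
             s ≡ pos z × t ≡ neg z
sign-split {s} (+ n) s+t≡n _ t≡0 with t≡0 (ℤₚ.≤⇒≯ (ℤ.+≤+ z≤n))
... | refl = trans (sym (+-identityʳ s)) s+t≡n , refl
sign-split -[1+ n ] s+t≡n s≡0 _ with s≡0 (ℤₚ.<-asym ℤ.-<+)
... | refl = refl , s+t≡n

-- The negative part is moved to the left so that both stub counts stay natural numbers.
pos-neg : ∀ z k → z ℤ.* + k +ℤ + (k * neg z) ≡ + (k * pos z)
pos-neg (+ n) k rewrite *-zeroʳ k =
  trans (ℤₚ.+-identityʳ _) (trans (sym (ℤₚ.pos-* n k)) (cong +_ (*-comm n k)))
pos-neg -[1+ n ] k rewrite *-zeroʳ k = begin
  -[1+ n ] ℤ.* + k +ℤ + (k * suc n)             ≡⟨ cong (_+ℤ + (k * suc n)) (ℤₚ.neg-distribˡ-* (+ suc n) (+ k)) ⟨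
  ℤ.- (+ suc n ℤ.* + k) +ℤ + (k * suc n)        ≡⟨ cong (λ z → ℤ.- z +ℤ + (k * suc n)) (trans (sym (ℤₚ.pos-* (suc n) k)) (cong +_ (*-comm (suc n) k))) ⟩
  ℤ.- + (k * suc n) +ℤ + (k * suc n)            ≡⟨ ℤₚ.+-inverseˡ (+ (k * suc n)) ⟩
  + 0                                            ∎
  where open ≡-Reasoning

sumℤ-split : ∀ {n} (c : Fin n → ℤ) (x : Fin n → ℕ) →
  sumℤ (λ i → c i ℤ.* + x i) +ℤ + sum (λ i → x i * neg (c i)) ≡ + sum (λ i → x i * pos (c i))
sumℤ-split {zero}  c x = refl
sumℤ-split {suc n} c x = begin
  (u +ℤ U) +ℤ (v +ℤ V)   ≡⟨ ℤₚ.+-assoc u U (v +ℤ V) ⟩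
  u +ℤ (U +ℤ (v +ℤ V))   ≡⟨ cong (u +ℤ_) (ℤₚ.+-assoc U v V) ⟨
  u +ℤ ((U +ℤ v) +ℤ V)   ≡⟨ cong (λ z → u +ℤ (z +ℤ V)) (ℤₚ.+-comm U v) ⟩
  u +ℤ ((v +ℤ U) +ℤ V)   ≡⟨ cong (u +ℤ_) (ℤₚ.+-assoc v U V) ⟩
  u +ℤ (v +ℤ (U +ℤ V))   ≡⟨ ℤₚ.+-assoc u v (U +ℤ V) ⟨
  (u +ℤ v) +ℤ (U +ℤ V)   ≡⟨ cong₂ _+ℤ_ (pos-neg (c zero) (x zero)) (sumℤ-split (c ∘ suc) (x ∘ suc)) ⟩
  + (x zero * pos (c zero)) +ℤ + sum (λ i → x (suc i) * pos (c (suc i))) ∎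
  where
  open ≡-Reasoning
  u = c zero ℤ.* + x zero
  v = + (x zero * neg (c zero))
  U = sumℤ (λ i → c (suc i) ℤ.* + x (suc i))
  V = + sum (λ i → x (suc i) * neg (c (suc i)))

-- There are as many positive stubs as negative ones.
Balanced : ∀ {n} → (Fin n → ℤ) → (Fin n → ℕ) → Set
Balanced c x = sum (λ i → x i * pos (c i)) ≡ sum (λ i → x i * neg (c i))

module _ {m n} (A : Fin m → Fin n → ℤ) (b : Fin m → ℤ) (x : Fin (suc n) → ℕ) (x₀≡1 : x zero ≡ 1) (j : Fin m) where

  private
    S = sumℤ (λ i → A j i ℤ.* + x (suc i))

    -- Variable 0 occurs once and has coefficient `- b j`.
    total≡ : sumℤ (λ i → coef A b j i ℤ.* + x i) ≡ S ℤ.- b j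
    total≡ rewrite x₀≡1 = trans (cong (_+ℤ S) (ℤₚ.*-identityʳ (ℤ.- b j))) (ℤₚ.+-comm (ℤ.- b j) S)

  solution⇒balanced : S ≡ b j → Balanced (coef A b j) x
  solution⇒balanced S≡b = sym (ℤₚ.+-injective (trans (sym (ℤₚ.+-identityˡ _))
    (trans (cong (_+ℤ + sum (λ i → x i * neg (coef A b j i))) (sym (trans total≡ (ℤₚ.i≡j⇒i-j≡0 S≡b)))) (sumℤ-split (coef A b j) x))))

  balanced⇒solution : Balanced (coef A b j) x → S ≡ b j
  balanced⇒solution bal = ℤₚ.i-j≡0⇒i≡j S (b j) (trans (sym total≡)
    (identityˡ-unique _ _ (trans (sumℤ-split (coef A b j) x) (cong +_ bal))))

-- From graphs to solutions

sum-by-label : ∀ {N n} (label : Fin N → Fin n) (g : Fin n → ℕ) →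
  sum (λ v → g (label v)) ≡ sum (λ i → count (λ v → ⌊ label v ≟ i ⌋) * g i)
sum-by-label label g = begin
  sum (λ v → g (label v))                               ≡⟨ sum-cong-≗ (λ v → sum-δ (label v) g) ⟨
  sum (λ v → sum (λ i → δ (label v) i * g i))           ≡⟨ ∑-comm (λ v i → δ (label v) i * g i) ⟩
  sum (λ i → sum (λ v → δ (label v) i * g i))           ≡⟨ sum-cong-≗ (λ i → *-distribʳ-sum (g i) (λ v → δ (label v) i)) ⟨
  sum (λ i → sum (λ v → δ (label v) i) * g i)           ≡⟨ sum-cong-≗ (λ i → cong (_* g i) (count≡sum (λ v → ⌊ label v ≟ i ⌋))) ⟨
  sum (λ i → count (λ v → ⌊ label v ≟ i ⌋) * g i)       ∎
  where open ≡-Reasoning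

incidence : ∀ {M m N} → (Fin M → Fin m) → (Fin M → Fin N) → Fin m → Fin N → ℕ
incidence col end j v = count (λ e → ⌊ col e ≟ j ⌋ ∧ ⌊ end e ≟ v ⌋)

incidence≡sum : ∀ {M m N} (col : Fin M → Fin m) (end : Fin M → Fin N) j v →
  incidence col end j v ≡ sum (λ e → δ (col e) j * δ (end e) v)
incidence≡sum col end j v = trans (count≡sum λ e → ⌊ col e ≟ j ⌋ ∧ ⌊ end e ≟ v ⌋) (sum-cong-≗ λ e → ind-∧ ⌊ col e ≟ j ⌋ ⌊ end e ≟ v ⌋)

-- Double counting, as each edge has one end of the given kind. The right side does not mention
-- `end`, so sources and targets give the same total.
sum-incidence : ∀ {M m N} (col : Fin M → Fin m) (end : Fin M → Fin N) j →
  sum (incidence col end j) ≡ sum (λ e → δ (col e) j)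
sum-incidence col end j = begin
  sum (incidence col end j)                         ≡⟨ sum-cong-≗ (incidence≡sum col end j) ⟩
  sum (λ v → sum (λ e → δ (col e) j * δ (end e) v)) ≡⟨ ∑-comm (λ v e → δ (col e) j * δ (end e) v) ⟩
  sum (λ e → sum (λ v → δ (col e) j * δ (end e) v)) ≡⟨ sum-cong-≗ (λ e → *-distribˡ-sum (δ (col e) j) (δ (end e))) ⟨
  sum (λ e → δ (col e) j * sum (δ (end e)))         ≡⟨ sum-cong-≗ (λ e → cong (δ (col e) j *_) (sum-δ1 (end e))) ⟩
  sum (λ e → δ (col e) j * 1)                       ≡⟨ sum-cong-≗ (λ e → *-identityʳ (δ (col e) j)) ⟩
  sum (λ e → δ (col e) j)                           ∎
  where open ≡-Reasoning

incidence-zero : ∀ {M m N} (col : Fin M → Fin m) (end : Fin M → Fin N) j v →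
  (∀ e → col e ≡ j → end e ≢ v) → incidence col end j v ≡ 0
incidence-zero col end j v no-edge = trans (incidence≡sum col end j v) (sum-zero term)
  where
  term : ∀ e → δ (col e) j * δ (end e) v ≡ 0
  term e with col e ≟ j
  ... | no _  = refl
  ... | yes c = trans (+-identityʳ _) (δ-≢ (no-edge e c))

graph⇒feasible : ∀ {m n} (A : Fin m → Fin n → ℤ) b (G : LGraph m n) → InClass A b G → Feasible A b
graph⇒feasible A b G (size₀ , edges , degrees) = sol G , λ j →
  balanced⇒solution A b (classSize G) size₀ j (balanced j)
  where
  open ≡-Reasoning
  out-in : ∀ j v → incidence (col G) (src G) j v ≡ pos (coef A b j (label G v)) ×
                   incidence (col G) (tgt G) j v ≡ neg (coef A b j (label G v))
  out-in j v = sign-split (coef A b j (label G v)) (degrees j v)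
    -- A source of an edge of colour `j` has a positive coefficient, a target a negative one.
    (λ ¬0< → incidence-zero (col G) (src G) j v λ { e refl refl → ¬0< (proj₁ (edges e)) })
    (λ ¬<0 → incidence-zero (col G) (tgt G) j v λ { e refl refl → ¬<0 (proj₂ (edges e)) })
  balanced : ∀ j → Balanced (coef A b j) (classSize G)
  balanced j = begin
    sum (λ i → classSize G i * pos (coef A b j i))  ≡⟨ sum-by-label (label G) (pos ∘ coef A b j) ⟨
    sum (λ v → pos (coef A b j (label G v)))        ≡⟨ sum-cong-≗ (λ v → proj₁ (out-in j v)) ⟨
    sum (incidence (col G) (src G) j)               ≡⟨ sum-incidence (col G) (src G) j ⟩
    sum (λ e → δ (col G e) j)                       ≡⟨ sum-incidence (col G) (tgt G) j ⟨
    sum (incidence (col G) (tgt G) j)               ≡⟨ sum-cong-≗ (λ v → proj₂ (out-in j v)) ⟩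
    sum (λ v → neg (coef A b j (label G v)))        ≡⟨ sum-by-label (label G) (neg ∘ coef A b j) ⟩
    sum (λ i → classSize G i * neg (coef A b j i))  ∎

-- From solutions to graphs

⌊⌋⁻ : ∀ {a} {A : Set a} (d : Dec A) → ⌊ d ⌋ ≡ true → A
⌊⌋⁻ (yes a) _ = a

⌊⌋⁺ : ∀ {a} {A : Set a} (d : Dec A) → A → ⌊ d ⌋ ≡ true
⌊⌋⁺ (yes _) _ = refl
⌊⌋⁺ (no ¬a) a = ⊥-elim (¬a a)

∈-tabulate⁺ : ∀ {N} {f : Fin N → Bool} {v} → f v ≡ true → v ∈ₛ tabulate f
∈-tabulate⁺ {f = f} {v} fv = lookup⇒[]= v _ (trans (lookup∘tabulate f v) fv)

∈-tabulate⁻ : ∀ {N} {f : Fin N → Bool} {v} → v ∈ₛ tabulate f → f v ≡ true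
∈-tabulate⁻ {f = f} {v} v∈ = trans (sym (lookup∘tabulate f v)) ([]=⇒lookup v∈)

∣tabulate∣ : ∀ {N} (f : Fin N → Bool) → ∣ tabulate f ∣ ≡ sum (ind ∘ f)
∣tabulate∣ {zero}  f = refl
∣tabulate∣ {suc N} f with f zero
... | true  = cong suc (∣tabulate∣ (f ∘ suc))
... | false = ∣tabulate∣ (f ∘ suc)

∣! : ∀ {k m} → .{{NonZero k}} → k ≤ m → k ∣ m !
∣! {suc k} k≤m = ∣-trans (m∣m*n (k !)) (m≤n⇒m!∣n! k≤m)

-- Bags along a common timeline

module Timeline {n} (x : Fin (suc n) → ℕ) (x₀≡1 : x zero ≡ 1) (D : ℕ) .{{_ : NonZero D}} where
  open Copies x

  -- At time q / D the variable i has completed ⌊ x i * q / D ⌋ of its copies.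
  clock : Fin (suc n) → ℕ → ℕ
  clock i q = x i * q / D

  Alive : ℕ → Fin (suc n) → ℕ → Set
  Alive q i k = clock i q ≤ k × k ≤ suc (clock i q)

  alive? : ∀ q i k → Dec (Alive q i k)
  alive? q i k = (clock i q ≤? k) ×-dec (k ≤? suc (clock i q))

  bagAt : ℕ → Subset (sum x)
  bagAt q = tabulate (λ v → ⌊ alive? q (index v) (copy v) ⌋)

  alive⇒∈ : ∀ {q v} → Alive q (index v) (copy v) → v ∈ₛ bagAt q
  alive⇒∈ {q} {v} al = ∈-tabulate⁺ (⌊⌋⁺ (alive? q (index v) (copy v)) al)

  ∈⇒alive : ∀ {q v} → v ∈ₛ bagAt q → Alive q (index v) (copy v)
  ∈⇒alive {q} {v} v∈ = ⌊⌋⁻ (alive? q (index v) (copy v)) (∈-tabulate⁻ v∈)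

  clock-mono : ∀ i {p q} → p ≤ q → clock i p ≤ clock i q
  clock-mono i p≤q = /-monoˡ-≤ D (*-monoʳ-≤ (x i) p≤q)

  -- The clock is monotone, so the upper bound on `k` is inherited from `p` and the lower bound from
  -- `r`.
  alive-convex : ∀ {i k p q r} → p ≤ q → q ≤ r → Alive p i k → Alive r i k → Alive q i k
  alive-convex {i} p≤q q≤r (_ , k≤) (≤k , _) =
    ≤-trans (clock-mono i q≤r) ≤k , ≤-trans k≤ (s≤s (clock-mono i p≤q))

  -- The time `p / T` equals `p * d / D`. Multiplying both inequalities of `Timely` by `d` and
  -- rounding down gives the two bounds.
  timely⇒alive : ∀ {T} d p v → D ≡ d * T → Timely x T p v → Alive (p * d) (index v) (copy v)
  timely⇒alive {T} zero p v D≡0 _ = ⊥-elim (ℕ.≢-nonZero⁻¹ D D≡0)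
  timely⇒alive {T} d@(suc _) p v D≡dT (early , late) = upper , lower (copy v) early
    where
    open ≤-Reasoning
    i = index v
    k*T*d : ∀ k → k * T * d ≡ k * D
    k*T*d k = trans (*-assoc k T d) (cong (k *_) (trans (*-comm T d) (sym D≡dT)))
    upper : x i * (p * d) / D ≤ copy v
    upper = ≤-pred (m<n*o⇒m/o<n {n = suc (copy v)} (begin-strict
      x i * (p * d)       ≡⟨ *-assoc (x i) p d ⟨
      x i * p * d         <⟨ *-monoˡ-< d late ⟩
      suc (copy v) * T * d ≡⟨ k*T*d (suc (copy v)) ⟩
      suc (copy v) * D    ∎))
    lower : ∀ k → k * T < x i * p + T → k ≤ suc (x i * (p * d) / D)
    lower zero    _  = z≤n
    lower (suc k) lt = s≤s (begin
      k                   ≡⟨ m*n/n≡m k D ⟨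
      k * D / D           ≤⟨ /-monoˡ-≤ D (begin
        k * D             ≡⟨ k*T*d k ⟨
        k * T * d         ≤⟨ *-monoˡ-≤ d (+-cancelˡ-≤ T _ _ (≤-trans (<⇒≤ lt) (≤-reflexive (+-comm _ T)))) ⟩
        x i * p * d       ≡⟨ *-assoc (x i) p d ⟩
        x i * (p * d)     ∎) ⟩
      x i * (p * d) / D   ∎)

  -- The share of each variable in a bag. Variable 0 has a single copy, whence `2 * n + 1` in total
  -- and width `2 * n`.
  cap : Fin (suc n) → ℕ
  cap zero    = 1
  cap (suc _) = 2

  ind≤1 : ∀ b → ind b ≤ 1
  ind≤1 true  = ≤-refl
  ind≤1 false = z≤n

  alive≤cap : ∀ q i → sum {x i} (λ k → ind ⌊ alive? q i (toℕ k) ⌋) ≤ cap i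
  alive≤cap q zero = ≤-trans (sum-mono {x zero} λ k → ind≤1 ⌊ alive? q zero (toℕ k) ⌋)
    (≤-reflexive (trans (sum-const (x zero) 1) (trans (*-identityʳ (x zero)) x₀≡1)))
  alive≤cap q i@(suc _) = begin
    sum {x i} (λ k → ind ⌊ alive? q i (toℕ k) ⌋)
      ≤⟨ sum-mono {x i} (λ k → ind≤ (alive? q i (toℕ k)) (two (toℕ k))) ⟩
    sum {x i} (λ k → eqℕ (clock i q) (toℕ k) + eqℕ (suc (clock i q)) (toℕ k))
      ≡⟨ ∑-distrib-+ {x i} (λ k → eqℕ (clock i q) (toℕ k)) (λ k → eqℕ (suc (clock i q)) (toℕ k)) ⟩
    sum {x i} (λ k → eqℕ (clock i q) (toℕ k)) + sum {x i} (λ k → eqℕ (suc (clock i q)) (toℕ k))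
      ≤⟨ +-mono-≤ (sum-eqℕ≤1 (x i) (clock i q)) (sum-eqℕ≤1 (x i) (suc (clock i q))) ⟩
    2 ∎
    where
    open ≤-Reasoning
    two : ∀ k → Alive q i k → 1 ≤ eqℕ (clock i q) k + eqℕ (suc (clock i q)) k
    two k (≤k , k≤) with m≤n⇒m<n∨m≡n ≤k
    ... | inj₂ eq = ≤-trans (≤-reflexive (sym (trans (cong (eqℕ _) (sym eq)) (eqℕ-refl (clock i q))))) (m≤m+n _ _)
    ... | inj₁ lt = ≤-trans (≤-reflexive (sym (trans (cong (eqℕ _) (≤-antisym k≤ lt)) (eqℕ-refl (suc (clock i q))))))
                            (m≤n+m _ (eqℕ (clock i q) k))

  bag-width : ∀ q → ∣ bagAt q ∣ ≤ suc (2 * n)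
  bag-width q = begin
    ∣ bagAt q ∣                                                 ≡⟨ ∣tabulate∣ (λ v → ⌊ alive? q (index v) (copy v) ⌋) ⟩
    sum (λ v → ind ⌊ alive? q (index v) (copy v) ⌋)             ≡⟨ sum-vertices (λ i k → ind ⌊ alive? q i k ⌋) ⟩
    sum (λ i → sum {x i} (λ k → ind ⌊ alive? q i (toℕ k) ⌋))    ≤⟨ sum-mono (alive≤cap q) ⟩
    sum cap                                                     ≡⟨ cong suc (trans (sum-const n 2) (*-comm n 2)) ⟩
    suc (2 * n)                                                 ∎
    where open ≤-Reasoning

-- The graph and its path decomposition

module Construction {m n} (A : Fin m → Fin n → ℤ) (b : Fin m → ℤ)
  (x : Fin (suc n) → ℕ) (x₀≡1 : x zero ≡ 1) (balanced : ∀ j → Balanced (coef A b j) x) where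
  open Copies x

  -- The number of edges of colour `j`; by `balanced` the negative stubs give the same number.
  T : Fin m → ℕ
  T j = sum (λ i → x i * pos (coef A b j i))

  source : ∀ j → _
  source j = endpoints x (pos ∘ coef A b j) (T j) refl

  target : ∀ j → _
  target j = endpoints x (neg ∘ coef A b j) (T j) (sym (balanced j))

  colour : Fin (sum T) → Fin m
  colour e = proj₁ (dec T e)

  slot : ∀ e → Fin (T (colour e))
  slot e = proj₂ (dec T e)

  G : LGraph m n
  G = record
    { N     = sum x
    ; M     = sum T
    ; label = index
    ; src   = λ e → proj₁ (source (colour e)) (slot e)
    ; tgt   = λ e → proj₁ (target (colour e)) (slot e)
    ; col   = colour
    }

  -- Only the block of colour `j` contributes. Abstracting over `end` covers sources and targets
  -- alike.
  incidence-slots : (end : ∀ j → Fin (T j) → Fin (sum x)) → ∀ j v →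
    incidence colour (λ e → end (colour e) (slot e)) j v ≡ sum (λ p → δ (end j p) v)
  incidence-slots end j v = begin
    incidence colour (λ e → end (colour e) (slot e)) j v
      ≡⟨ incidence≡sum colour _ j v ⟩
    sum (λ e → F (dec T e))
      ≡⟨ sum-enc T (F ∘ dec T) ⟩
    sum (λ j′ → sum (λ p → F (dec T (enc T j′ p))))
      ≡⟨ sum-cong-≗ (λ j′ → sum-cong-≗ λ p → cong F (dec-enc T j′ p)) ⟩
    sum (λ j′ → sum (λ p → δ j′ j * δ (end j′ p) v))
      ≡⟨ sum-cong-≗ (λ j′ → *-distribˡ-sum (δ j′ j) (λ p → δ (end j′ p) v)) ⟨
    sum (λ j′ → δ j′ j * sum (λ p → δ (end j′ p) v))
      ≡⟨ sum-δʳ j (λ j′ → sum (λ p → δ (end j′ p) v)) ⟩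
    sum (λ p → δ (end j p) v) ∎
    where
    open ≡-Reasoning
    F : Σ[ j′ ∈ Fin m ] Fin (T j′) → ℕ
    F (j′ , p) = δ j′ j * δ (end j′ p) v

  inClass : InClass A b G
  inClass = size₀
    , (λ e → let (_ , _ , s) = source (colour e) ; (_ , _ , t) = target (colour e) in
         0<pos⇒0< _ (proj₁ (s (slot e))) , 0<neg⇒<0 _ (proj₁ (t (slot e))))
    , λ j v → trans (cong₂ _+_
        (trans (incidence-slots (λ j → proj₁ (source j)) j v) (proj₁ (proj₂ (source j)) v))
        (trans (incidence-slots (λ j → proj₁ (target j)) j v) (proj₁ (proj₂ (target j)) v)))
        (pos+neg (coef A b j (index v)))
    where
    open ≡-Reasoning
    size₀ : classSize G zero ≡ 1
    size₀ = begin
      count (λ v → ⌊ index v ≟ zero ⌋)          ≡⟨ count≡sum (λ v → ⌊ index v ≟ zero ⌋) ⟩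
      sum (λ v → δ (index v) zero)              ≡⟨ sum-vertices (λ i _ → δ i zero) ⟩
      sum (λ i → sum {x i} (λ _ → δ i zero))    ≡⟨ sum-cong-≗ (λ i → trans (sum-const (x i) (δ i zero)) (*-comm (x i) (δ i zero))) ⟩
      sum (λ i → δ i zero * x i)                ≡⟨ sum-δʳ zero x ⟩
      x zero                                    ≡⟨ x₀≡1 ⟩
      1                                         ∎

  -- A common multiple of all x i > 0 and all T j > 0.
  D : ℕ
  D = (sum x + sum T) !

  instance
    D≢0 : NonZero D
    D≢0 = (sum x + sum T) !≢0

  open Timeline x x₀≡1 D {{D≢0}}

  moment : ∀ {k d t} → k < t → D ≡ d * t → k * d < D
  moment {d = zero} _ D≡0 = ⊥-elim (ℕ.≢-nonZero⁻¹ D D≡0)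
  moment {k} {d@(suc _)} {t} k<t D≡dt =
    <-≤-trans (*-monoˡ-< d k<t) (≤-reflexive (trans (*-comm t d) (sym D≡dt)))

  pathDecomposition : PathDecomposition G (2 * n)
  pathDecomposition = record
    { L        = D
    ; bag      = λ q → bagAt (toℕ q)
    ; coverV   = coverVertex
    ; coverE   = coverEdge
    ; interval = λ v p q r p≤q q≤r v∈p v∈r →
        alive⇒∈ (alive-convex p≤q q≤r (∈⇒alive {toℕ p} v∈p) (∈⇒alive {toℕ r} v∈r))
    ; width    = λ q → bag-width (toℕ q)
    }
    where
    coverVertex : ∀ v → ∃ λ (q : Fin D) → v ∈ₛ bagAt (toℕ q)
    -- Copy `k` of variable `i` lies in the bag at time `k / x i`, where the clock of `i` shows
    -- exactly `k`.
    coverVertex v with ∣! {{ℕ.>-nonZero (≤-<-trans z≤n (copy< v))}}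
                          (≤-trans (≤sum x (index v)) (m≤m+n (sum x) (sum T)))
    ... | divides d D≡dx = fromℕ< q<D , subst (λ q → v ∈ₛ bagAt q) (sym (toℕ-fromℕ< q<D))
      (alive⇒∈ (≤-reflexive clock≡ , ≤-trans (≤-reflexive (sym clock≡)) (n≤1+n _)))
      where
      q<D = moment (copy< v) D≡dx
      clock≡ : clock (index v) (copy v * d) ≡ copy v
      clock≡ = trans (cong (_/ D) (begin
        x (index v) * (copy v * d)   ≡⟨ *-comm (x (index v)) _ ⟩
        copy v * d * x (index v)     ≡⟨ *-assoc (copy v) d _ ⟩
        copy v * (d * x (index v))   ≡⟨ cong (copy v *_) D≡dx ⟨
        copy v * D                   ∎)) (m*n/n≡m (copy v) D)
        where open ≡-Reasoning
    coverEdge : ∀ e → ∃ λ (q : Fin D) → src G e ∈ₛ bagAt (toℕ q) × tgt G e ∈ₛ bagAt (toℕ q)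
    -- The edge in slot `p` of colour `j` is covered at time `p / T j`, where both of its endpoints
    -- are timely.
    coverEdge e with ∣! {{ℕ.>-nonZero (≤-<-trans z≤n (toℕ<n (slot e)))}}
                        (≤-trans (≤sum T (colour e)) (m≤n+m (sum T) (sum x)))
    ... | divides d D≡dT = fromℕ< q<D , inBag (src G e) (proj₂ (proj₂ (proj₂ (source (colour e))) (slot e)))
                                      , inBag (tgt G e) (proj₂ (proj₂ (proj₂ (target (colour e))) (slot e)))
      where
      q<D = moment (toℕ<n (slot e)) D≡dT
      inBag : ∀ v → Timely x (T (colour e)) (toℕ (slot e)) v → v ∈ₛ bagAt (toℕ (fromℕ< q<D))
      inBag v timely = subst (λ q → v ∈ₛ bagAt q) (sym (toℕ-fromℕ< q<D))
        (alive⇒∈ (timely⇒alive d (toℕ (slot e)) v D≡dT timely))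

-- The value 1 at variable 0 provides the single vertex of that label, which carries the right-hand
-- side `b`.
withUnit : ∀ {n} → (Fin n → ℕ) → Fin (suc n) → ℕ
withUnit x zero    = 1
withUnit x (suc i) = x i

feasible⇒graph : ∀ {m n} (A : Fin m → Fin n → ℤ) b → Feasible A b →
  Σ (LGraph m n) (λ G → InClass A b G × PathWidth≤ G (2 * n))
feasible⇒graph A b (x , Ax≡b) = G , inClass , pathDecomposition
  where open Construction A b (withUnit x) refl
               (λ j → solution⇒balanced A b (withUnit x) refl j (Ax≡b j))

mainTheorem2 : ∀ (m n : ℕ) (A : Fin m → Fin n → ℤ) (b : Fin m → ℤ) →
    Feasible A b ⇔ Σ (LGraph m n) (λ G → InClass A b G × PathWidth≤ G (2 * n))
mainTheorem2 m n A b = mk⇔ (feasible⇒graph A b) λ (G , inClass , _) → graph⇒feasible A b G inClass
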